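{- Let $H=(V,E,w)$ be a weighted undirected hypergraph with source $s\in V$, and let the weight of a hyperedge $\check e\in E$ decrease to $w_{new}$. Let $d[v]$ and $d'[v]$ denote the shortest distance from $s$ to $v$ before and after the change, respectively. Suppose that before the weight decrease $D[v]=d[v]$ and $E[v]$, $P[v]$ are correct for all $v\in V$. Then after the algorithm HE-DSP: Weight Decrease$(\check e,w_{new})$ (given in the context) has been executed, $D[v]=d'[v]$ and $E[v]$ and $P[v]$ are correctly updated (i.e. they are correct for the hypergraph with the new weight) for all $v\in V$.
   Context: A weighted undirected hypergraph $H=(V,E,w)$ consists of a finite set $V$, a family $E$ of nonempty subsets of $V$ (hyperedges) with $\bigcup_{e\in E}e=V$, and a weight function $w:E\to\mathbb{R}^+\cup\{0\}$. A hyperpath between $u$ and $v$ is a sequence of hyperedges $\{e_0,\dots,e_m\}$ with $u\in e_0$, $v\in e_m$ and $e_i\cap e_{i+1}\neq\emptyset$ for $i=0,\dots,m-1$; its weight is $\sum_{i=0}^m w(e_i)$. The shortest distance of $v$ is the minimum weight of a hyperpath from $s$ to $v$ ($0$ for $v=s$, $+\infty$ if there is none). The algorithm stores for each vertex $v$: $D[v]$ (current distance value), $P[v]$ (parent of $v$), and $E[v]$ (the hyperedge containing $v$ and $P[v]$ that leads from $P[v]$ to $v$ on the shortest hyperpath). "$P$ and $E$ are correct" means that they describe shortest hyperpaths from $s$: the parent pointers form a tree rooted at $s$ (a relationship tree) on the vertices reachable from $s$, and for each reachable $v\neq s$, $E[v]$ contains $v$ and $P[v]$, and the shortest distance of $v$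 equals the shortest distance of $P[v]$ plus $w(E[v])$; thus following the pointers from $v$ back to $s$ gives a shortest hyperpath to $v$. Algorithm HE-DSP: Weight Decrease$(\check e,w_{new})$. $Q$ is an initially empty priority queue of vertices keyed by $D$; Dequeue removes and returns a vertex with smallest key. Step 0. Set $w(\check e)\leftarrow w_{new}$. Step 1. Let $x\in\arg\min_{v\in\check e}D[v]$. For each $v\in\check e$ with $D[x]+w_{new}<D[v]$: set $D[v]\leftarrow D[x]+w_{new}$, $P[v]\leftarrow x$, $E[v]\leftarrow\check e$, and enqueue $v$ into $Q$ with key $D[v]$. Step 2. While $Q$ is nonempty: dequeue $z$ from $Q$; for each $e\in E$ with $z\in e$ and each $v\in e$, if $D[v]>D[z]+w(e)$, set $D[v]\leftarrow D[z]+w(e)$, $P[v]\leftarrow z$, $E[v]\leftarrow e$, and enqueue $v$ into $Q$ with key $D[v]$ (or update its key if it is already in $Q$). -}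

module Defs where

open import Algebra.Structures using (IsAbelianGroup)
open import Data.Bool.Base using (if_then_else_)
open import Data.Fin.Base using (Fin)
open import Data.Fin.Properties using (_≟_)
open import Data.Fin.Subset
  using (Subset; _∈_; _∩_; _∪_; _─_; ⁅_⁆; ⊥; Nonempty; Empty)
open import Data.Fin.Subset.Properties using (_∈?_)
open import Data.List.Base
  using (List; foldl; foldr; filter; allFin; cartesianProduct)
open import Data.List.NonEmpty.Base using (List⁺; head; last; toList)
open import Data.List.Relation.Binary.Permutation.Propositional using (_↭_)
open import Data.List.Relation.Unary.Linked using (Linked)
open import Data.Maybe.Base using (Maybe; just; nothing)
open import Data.Nat.Base using (ℕ)
open import Data.Product.Base using (∃; ∃₂; _×_; _,_)
open import Data.Vec.Functional using (Vector; updateAt)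
open import Data.Vec.Functional.Properties
  using (updateAt-updates; updateAt-minimal)
open import Function.Base using (const)
open import Induction.WellFounded using (Acc)
open import Level using (Level; _⊔_; suc)
open import Relation.Binary.Core using (Rel)
open import Relation.Binary.Construct.Closure.ReflexiveTransitive using (Star)
open import Relation.Binary.PropositionalEquality.Core
  using (_≡_; _≢_; refl; sym; subst)
open import Relation.Binary.Structures using (IsDecTotalOrder)
open import Relation.Nullary.Construct.Add.Supremum using (_⁺; ⊤⁺; [_])
open import Relation.Nullary.Decidable.Core using (does; yes; no; _×-dec_)
open import Relation.Nullary.Negation.Core using (¬_)
import Relation.Binary.Construct.Add.Supremum.Equality as SupEquality
import Relation.Binary.Construct.Add.Supremum.NonStrict as SupNonStrict
import Relation.Binary.Construct.Add.Supremum.Strict as SupStrict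
import Relation.Binary.Construct.NonStrictToStrict as ToStrict

-- The weights live in an arbitrary linearly ordered abelian group. The real
-- numbers, with classical (decidable) comparisons, are the intended instance;
-- only their addition and order play a role in what follows.

record OrderedAbelianGroup c ℓ₁ ℓ₂ : Set (suc (c ⊔ ℓ₁ ⊔ ℓ₂)) where
  infix  4 _≈_ _≤_
  infixl 6 _+_
  field
    Carrier         : Set c
    _≈_             : Rel Carrier ℓ₁
    _≤_             : Rel Carrier ℓ₂
    _+_             : Carrier → Carrier → Carrier
    0#              : Carrier
    -_              : Carrier → Carrier
    isAbelianGroup  : IsAbelianGroup _≈_ _+_ 0# -_
    isDecTotalOrder : IsDecTotalOrder _≈_ _≤_
    +-monoˡ-≤       : ∀ z {x y} → x ≤ y → (x + z) ≤ (y + z)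

  open ToStrict _≈_ _≤_ public using (_<_)

module HyperpathDefs {c ℓ₁ ℓ₂ : Level} (G : OrderedAbelianGroup c ℓ₁ ℓ₂) where

  open OrderedAbelianGroup G
  open IsDecTotalOrder isDecTotalOrder using (_≤?_)
    renaming (_≟_ to _≈?_)
  open SupEquality  _≈_ public using (_≈⁺_)
  open SupNonStrict _≤_ public using (_≤⁺_)
  open SupStrict    _<_ public using (_<⁺_; <⁺-dec)

  -- Distances: weights together with +∞ = ⊤⁺.

  Distance : Set c
  Distance = Carrier ⁺

  infixl 6 _∔_
  _∔_ : Distance → Carrier → Distance
  [ x ] ∔ y = [ x + y ]
  ⊤⁺    ∔ y = ⊤⁺

  infix 4 _<⁺?_
  _<⁺?_ : (x y : Distance) → _
  _<⁺?_ = <⁺-dec (ToStrict.<-decidable _≈_ _≤_ _≈?_ _≤?_)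

  -- The vertex set is Fin n and the family of hyperedges is indexed by Fin m.

  record Hypergraph (n m : ℕ) : Set (c ⊔ ℓ₂) where
    field
      edge     : Fin m → Subset n
      nonempty : ∀ e → Nonempty (edge e)
      covers   : ∀ v → ∃ λ e → v ∈ edge e
      weight   : Vector Carrier m
      weight≥0 : ∀ e → 0# ≤ weight e

  open Hypergraph public

  reweight : ∀ {n m} → Hypergraph n m → Fin m → (w : Carrier) → 0# ≤ w →
             Hypergraph n m
  reweight H ě w 0≤w = record
    { edge     = edge H
    ; nonempty = nonempty H
    ; covers   = covers H
    ; weight   = updateAt (weight H) ě (const w)
    ; weight≥0 = nonneg
    }
    where
    nonneg : ∀ e → 0# ≤ updateAt (weight H) ě (const w) e
    nonneg e with e ≟ ě
    ... | yes refl = subst (0# ≤_) (sym (updateAt-updates e (weight H))) 0≤w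
    ... | no  e≢ě  = subst (0# ≤_) (sym (updateAt-minimal e ě (weight H) e≢ě))
                       (weight≥0 H e)

  module _ {n m : ℕ} (H : Hypergraph n m) where

    record Hyperpath (u v : Fin n) : Set where
      field
        edges  : List⁺ (Fin m)
        starts : u ∈ edge H (head edges)
        ends   : v ∈ edge H (last edges)
        linked : Linked (λ e f → Nonempty (edge H e ∩ edge H f)) (toList edges)

    pathWeight : ∀ {u v} → Hyperpath u v → Carrier
    pathWeight p = foldr (λ e x → weight H e + x) 0# (toList (Hyperpath.edges p))

    -- ShortestDistance s v d: the shortest distance of v from the source s is d.

    data ShortestDistance (s v : Fin n) : Distance → Set (c ⊔ ℓ₁ ⊔ ℓ₂) where
      source      : ∀ {x} → v ≡ s → x ≈ 0# → ShortestDistance s v [ x ]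
      minimum     : ∀ {x} → v ≢ s →
                    (p : Hyperpath s v) → x ≈ pathWeight p →
                    (∀ (q : Hyperpath s v) → x ≤ pathWeight q) →
                    ShortestDistance s v [ x ]
      unreachable : v ≢ s → ¬ Hyperpath s v → ShortestDistance s v ⊤⁺

  -- The arrays D, P and E. The source and the unreachable vertices have no
  -- parent, hence Maybe.

  record Labels (n m : ℕ) : Set c where
    field
      D : Vector Distance n
      P : Vector (Maybe (Fin n)) n
      E : Vector (Maybe (Fin m)) n

  open Labels public

  module _ {n m : ℕ} (H : Hypergraph n m) (s : Fin n) where

    -- Since covers puts s on a hyperedge, Hyperpath H s v says that v is
    -- reachable also when v is s itself. The first three fields say that the
    -- parent pointers form a tree rooted at s whose vertices are exactly the
    -- reachable ones.

    record CorrectPointers (L : Labels n m) : Set (c ⊔ ℓ₁ ⊔ ℓ₂) where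
      field
        root      : P L s ≡ nothing
        supported : ∀ {v u} → P L v ≡ just u → Hyperpath H s v
        connected : ∀ {v} → Hyperpath H s v →
                    Star (λ a b → P L a ≡ just b) v s
        tight     : ∀ {v} → Hyperpath H s v → v ≢ s →
                    ∃₂ λ u e → P L v ≡ just u × E L v ≡ just e ×
                      v ∈ edge H e × u ∈ edge H e ×
                      ∃₂ λ x y → ShortestDistance H s v x ×
                        ShortestDistance H s u y × x ≈⁺ y ∔ weight H e

    record Correct (L : Labels n m) : Set (c ⊔ ℓ₁ ⊔ ℓ₂) where
      field
        distances : ∀ v → ShortestDistance H s v (D L v)
        pointers  : CorrectPointers L

  -- The priority queue is the set of queued vertices. Keys need not be stored:
  -- every assignment to D[v] enqueues v or updates its key, so the key of a
  -- queued vertex is always its current D-value.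

  record State (n m : ℕ) : Set c where
    constructor _,_
    field
      labels : Labels n m
      queue  : Subset n

  open State public

  module _ {n m : ℕ} (H : Hypergraph n m) where

    relax : Fin n → State n m → Fin m × Fin n → State n m
    relax z (L , Q) (e , v) =
      if does (D L z ∔ weight H e <⁺? D L v)
      then (record { D = updateAt (D L) v (const (D L z ∔ weight H e))
                   ; P = updateAt (P L) v (const (just z))
                   ; E = updateAt (E L) v (const (just e))
                   } , Q ∪ ⁅ v ⁆)
      else (L , Q)

    -- z ∈ argmin over X of D.

    ArgMin : Labels n m → Subset n → Fin n → Set (c ⊔ ℓ₂)
    ArgMin L X z = z ∈ X × (∀ {u} → u ∈ X → D L z ≤⁺ D L u)

    members : Fin m → List (Fin n)
    members e = filter (_∈? edge H e) (allFin n)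

    incidences : Fin n → List (Fin m × Fin n)
    incidences z =
      filter (λ (e , v) → (z ∈? edge H e) ×-dec (v ∈? edge H e))
             (cartesianProduct (allFin m) (allFin n))

    -- The choice of the minimiser and the order in which the for-loops run are
    -- left open by the algorithm, so its steps are relations and the loops may
    -- run through any permutation of their index set.

    data Step₁ (ě : Fin m) (L : Labels n m) : State n m → Set (c ⊔ ℓ₂) where
      step₁ : ∀ {x vs} → ArgMin L (edge H ě) x → vs ↭ members ě →
              Step₁ ě L (foldl (λ σ v → relax x σ (ě , v)) (L , ⊥) vs)

    infix 4 _⟶_
    data _⟶_ : Rel (State n m) (c ⊔ ℓ₂) where
      step₂ : ∀ {L Q z evs} → ArgMin L Q z → evs ↭ incidences z →
              (L , Q) ⟶ foldl (relax z) (L , (Q ─ ⁅ z ⁆)) evs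

    Terminating : State n m → Set (c ⊔ ℓ₂)
    Terminating = Acc (λ τ σ → σ ⟶ τ)

    -- H carries the weights in force after step 0; L′ is a possible output on
    -- the input labels L.

    record Execution (ě : Fin m) (L L′ : Labels n m) : Set (c ⊔ ℓ₂) where
      field
        {σ τ}  : State n m
        first  : Step₁ ě L σ
        loop   : Star _⟶_ σ τ
        halted : Empty (queue τ)
        output : L′ ≡ labels τ

{-# OPTIONS --safe #-}
module Submission where

-- Three facts survive every relaxation, in whatever order relaxations occur:
-- D is nonnegative and vanishes at s, the parent pointers of the vertices with
-- finite D form a tree rooted at s, and D u + w e ≤ D v along every tree edge.
-- So D v bounds from above the weight of the tree path to v. When the queue is
-- empty no relaxation is possible, so D v is at most the weight of every
-- hyperpath and is therefore the shortest distance. That the queue is served in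
-- the order of D matters only for termination.

open import Algebra.Structures using (IsAbelianGroup)
open import Data.Fin.Base using (Fin)
open import Data.Fin.Properties using (_≟_)
open import Data.Fin.Subset
  using (Subset; inside; outside; _∈_; _∉_; _∪_; _─_; _⊃_; ⁅_⁆; ⊥; Empty)
open import Data.Fin.Subset.Induction using (⊃-wellFounded)
open import Data.Fin.Subset.Properties
  using (_∈?_; ∉⊥; x∈⁅x⁆; x∈⁅y⁆⇒x≡y; x≢y⇒x∉⁅y⁆; x∈p∩q⁺; x∈p∩q⁻;
         p⊆p∪q; q⊆p∪q; x∈p∪q⁻; x∈p∧x∉q⇒x∈p─q; p─q⊆p)
open import Data.List.Base
  using ([]; _∷_; foldl; map; initLast; _∷ʳ′_; allFin; cartesianProduct)
open import Data.List.Membership.Propositional.Properties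
  using (∈-filter⁺; ∈-allFin; ∈-cartesianProduct⁺)
open import Data.List.NonEmpty.Base using (_∷_; last)
open import Data.List.Properties using (foldl-map)
open import Data.List.Relation.Binary.Permutation.Propositional using (_↭_; ↭-sym)
open import Data.List.Relation.Binary.Permutation.Propositional.Properties
  using (All-resp-↭; ∈-resp-↭)
open import Data.List.Relation.Unary.All as All using (All; []; _∷_)
open import Data.List.Relation.Unary.All.Properties
  using (all-filter) renaming (map⁺ to All-map⁺; map⁻ to All-map⁻)
open import Data.List.Relation.Unary.Linked using ([-]; _∷_)
open import Data.Maybe.Base using (just; nothing)
open import Data.Nat.Base using (ℕ)
open import Data.Product.Base using (_×_; _,_; ∃; proj₁; proj₂)
open import Data.Sum.Base using (_⊎_; inj₁; inj₂)
open import Data.Unit.Base using (⊤)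
open import Data.Vec.Base using (_∷_; there)
open import Data.Vec.Functional using (updateAt)
open import Data.Vec.Functional.Properties using (updateAt-updates; updateAt-minimal)
open import Function.Base using (const; _∘_)
open import Induction.WellFounded using (Acc; acc)
open import Level using (_⊔_)
open import Relation.Binary.Bundles using (Poset)
open import Relation.Binary.Construct.Closure.ReflexiveTransitive using (Star; ε; _◅_)
import Relation.Binary.Construct.Add.Supremum.Equality as SupEquality
import Relation.Binary.Construct.Add.Supremum.NonStrict as SupNonStrict
import Relation.Binary.Construct.Add.Supremum.Strict as SupStrict
import Relation.Binary.Construct.NonStrictToStrict as ToStrict
open import Relation.Binary.PropositionalEquality.Core
  using (_≡_; _≢_; refl; sym; trans; cong; subst)
import Relation.Binary.Reasoning.PartialOrder as PosetReasoning
open import Relation.Binary.Structures using (IsDecTotalOrder)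
open import Relation.Nullary.Construct.Add.Supremum using (⊤⁺; [_])
open import Relation.Nullary.Decidable.Core using (yes; no; _×-dec_)
open import Relation.Nullary.Negation.Core using (¬_; contradiction)
open import Defs

-- Lists and subsets

-- `last` is computed through `initLast`, so it reduces only after a split on the shape of the tail.
last-∷ : ∀ {a} {A : Set a} (x y : A) zs → last (x ∷ y ∷ zs) ≡ last (y ∷ zs)
last-∷ x y zs with initLast zs
... | []       = refl
... | _ ∷ʳ′ _ = refl

x∈p─q⇒x∉q : ∀ {n x} (p q : Subset n) → x ∈ p ─ q → x ∉ q
x∈p─q⇒x∉q (_ ∷ p) (inside  ∷ q) (there x∈p─q) (there x∈q) = x∈p─q⇒x∉q p q x∈p─q x∈q
x∈p─q⇒x∉q (_ ∷ p) (outside ∷ q) (there x∈p─q) (there x∈q) = x∈p─q⇒x∉q p q x∈p─q x∈q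

module _ {c ℓ₁ ℓ₂} (G : OrderedAbelianGroup c ℓ₁ ℓ₂) where

  open OrderedAbelianGroup G
  open HyperpathDefs G
  open IsAbelianGroup isAbelianGroup
    using (assoc; comm; identityˡ; identityʳ) renaming (∙-cong to +-cong)
  open IsDecTotalOrder isDecTotalOrder
    using (antisym; total; isPartialOrder; ≤-respˡ-≈; ≤-respʳ-≈; module Eq)
    renaming (_≟_ to _≈?_; reflexive to ≤-reflexive; trans to ≤-trans)
  open SupEquality _≈_ using ([_]; ⊤⁺≈⊤⁺)
  open SupNonStrict _≤_ using ([_]; _≤⊤⁺; ≤⁺-isPartialOrder)
  open SupStrict _<_ using ([_]; [_]<⊤⁺)

  -- Order and addition on distances with +∞

  distancePoset : Poset _ _ _
  distancePoset = record { isPartialOrder = ≤⁺-isPartialOrder isPartialOrder }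

  open Poset distancePoset using ()
    renaming (refl to ≤⁺-refl; reflexive to ≤⁺-reflexive; trans to ≤⁺-trans; antisym to ≤⁺-antisym;
              module Eq to Eq⁺)
  open PosetReasoning distancePoset

  ≡⇒≤⁺ : ∀ {a b} → a ≡ b → a ≤⁺ b
  ≡⇒≤⁺ refl = ≤⁺-refl

  <⁺⇒≤⁺ : ∀ {a b} → a <⁺ b → a ≤⁺ b
  <⁺⇒≤⁺ [ x<y ]  = [ proj₁ x<y ]
  <⁺⇒≤⁺ [ x ]<⊤⁺ = [ x ] ≤⊤⁺

  <⁺⇒≱⁺ : ∀ {a b} → a <⁺ b → ¬ (b ≤⁺ a)
  <⁺⇒≱⁺ [ x<y ] [ y≤x ] = ToStrict.<⇒≱ _≈_ _≤_ antisym x<y y≤x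

  <⁺⇒≢⊤⁺ : ∀ {a b} → a <⁺ b → a ≢ ⊤⁺
  <⁺⇒≢⊤⁺ () refl

  ≮⁺⇒≥⁺ : ∀ {a b} → ¬ (a <⁺ b) → b ≤⁺ a
  ≮⁺⇒≥⁺ {[ x ]} {[ y ]} x≮y =
    [ ToStrict.≮⇒≥ _≈_ _≤_ Eq.sym _≈?_ ≤-reflexive total (x≮y ∘ [_]) ]
  ≮⁺⇒≥⁺ {[ x ]} {⊤⁺}    x≮y = contradiction [ x ]<⊤⁺ x≮y
  ≮⁺⇒≥⁺ {⊤⁺}            x≮y = _ ≤⊤⁺

  ≢⊤⁺-≤⁺ : ∀ {a b} → a ≤⁺ b → b ≢ ⊤⁺ → a ≢ ⊤⁺
  ≢⊤⁺-≤⁺ (_ ≤⊤⁺) ⊤≢⊤ refl = ⊤≢⊤ refl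

  ∔-≢⊤⁺ : ∀ {a x} → a ∔ x ≢ ⊤⁺ → a ≢ ⊤⁺
  ∔-≢⊤⁺ a∔x≢⊤ refl = a∔x≢⊤ refl

  +-monoʳ-≤ : ∀ z {x y} → x ≤ y → z + x ≤ z + y
  +-monoʳ-≤ z x≤y = ≤-respˡ-≈ (comm _ z) (≤-respʳ-≈ (comm _ z) (+-monoˡ-≤ z x≤y))

  ∔-monoˡ-≤⁺ : ∀ z {a b} → a ≤⁺ b → a ∔ z ≤⁺ b ∔ z
  ∔-monoˡ-≤⁺ z [ x≤y ]  = [ +-monoˡ-≤ z x≤y ]
  ∔-monoˡ-≤⁺ z (_ ≤⊤⁺) = _ ≤⊤⁺

  ∔-monoʳ-≤⁺ : ∀ a {x y} → x ≤ y → a ∔ x ≤⁺ a ∔ y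
  ∔-monoʳ-≤⁺ [ z ] x≤y = [ +-monoʳ-≤ z x≤y ]
  ∔-monoʳ-≤⁺ ⊤⁺    x≤y = ⊤⁺ ≤⊤⁺

  ∔-congˡ : ∀ a {x y} → x ≈ y → a ∔ x ≈⁺ a ∔ y
  ∔-congˡ [ z ] x≈y = [ +-cong Eq.refl x≈y ]
  ∔-congˡ ⊤⁺    x≈y = ⊤⁺≈⊤⁺

  ∔-congʳ : ∀ x {a b} → a ≈⁺ b → a ∔ x ≈⁺ b ∔ x
  ∔-congʳ x [ y≈z ]  = [ +-cong y≈z Eq.refl ]
  ∔-congʳ x ⊤⁺≈⊤⁺ = ⊤⁺≈⊤⁺

  ∔-assoc : ∀ a x y → a ∔ x ∔ y ≈⁺ a ∔ (x + y)
  ∔-assoc [ z ] x y = [ assoc z x y ]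
  ∔-assoc ⊤⁺    x y = ⊤⁺≈⊤⁺

  ∔-identityʳ : ∀ a → a ∔ 0# ≈⁺ a
  ∔-identityʳ [ z ] = [ identityʳ z ]
  ∔-identityʳ ⊤⁺    = ⊤⁺≈⊤⁺

  ≤⁺-∔ : ∀ a {x} → 0# ≤ x → a ≤⁺ a ∔ x
  ≤⁺-∔ a {x} 0≤x = begin
    a       ≈⟨ ∔-identityʳ a ⟨
    a ∔ 0#  ≤⟨ ∔-monoʳ-≤⁺ a 0≤x ⟩
    a ∔ x   ∎

  -- Hyperpaths as inductive walks

  module _ {n m : ℕ} (H : Hypergraph n m) where

    -- The end is the parameter and the start the index, so prepending a hyperedge changes only the
    -- index. Consecutive hyperedges share a named vertex, which gives the intermediate points for
    -- inductions along a walk.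
    data Walk (v : Fin n) : Fin n → Set where
      single : ∀ {u} e → u ∈ edge H e → v ∈ edge H e → Walk v u
      cons   : ∀ {u y} e → u ∈ edge H e → y ∈ edge H e → Walk v y → Walk v u

    -- The trailing `0#` is that of the `foldr` in `pathWeight`, so translating between walks and
    -- hyperpaths preserves weights up to `≡`.
    walkWeight : ∀ {u v} → Walk v u → Carrier
    walkWeight (single e _ _)  = weight H e + 0#
    walkWeight (cons e _ _ p)  = weight H e + walkWeight p

    toWalk : ∀ {u v} (p : Hyperpath H u v) → ∃ λ (q : Walk v u) → walkWeight q ≡ pathWeight H p
    toWalk p = go (Hyperpath.starts p) (Hyperpath.ends p) (Hyperpath.linked p)
      where
      go : ∀ {u v e es} (u∈e : u ∈ edge H e) (v∈ : v ∈ edge H (last (e ∷ es))) lk →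
           ∃ λ (q : Walk v u) → walkWeight q ≡
             pathWeight H {u} {v}
               (record { edges = e ∷ es ; starts = u∈e ; ends = v∈ ; linked = lk })
      go {es = []} u∈e v∈e [-] = single _ u∈e v∈e , refl
      go {v = v} {e} {f ∷ es} u∈e v∈ ((y , y∈e∩f) ∷ lk)
        with y∈e , y∈f ← x∈p∩q⁻ _ _ y∈e∩f
        with q , eq ← go y∈f (subst (λ g → v ∈ edge H g) (last-∷ e f es) v∈) lk
        = cons e u∈e y∈e q , cong (weight H e +_) eq

    fromWalk : ∀ {u v} (q : Walk v u) → ∃ λ (p : Hyperpath H u v) → pathWeight H p ≡ walkWeight q
    fromWalk (single e u∈e v∈e) =
      record { edges = e ∷ [] ; starts = u∈e ; ends = v∈e ; linked = [-] } , refl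
    fromWalk {v = v} (cons e u∈e y∈e q) with fromWalk q
    ... | record { edges = f ∷ fs ; starts = y∈f ; ends = v∈ ; linked = lk } , eq = record
      { edges  = e ∷ f ∷ fs
      ; starts = u∈e
      ; ends   = subst (λ g → v ∈ edge H g) (sym (last-∷ e f fs)) v∈
      ; linked = (_ , x∈p∩q⁺ (y∈e , y∈f)) ∷ lk
      } , cong (weight H e +_) eq

    -- Walks grow at the start, whereas the triangle inequality extends a shortest one at its end;
    -- reassociating the sum leaves only `≈`.
    snoc : ∀ {s u v} (p : Walk u s) e → u ∈ edge H e → v ∈ edge H e →
           ∃ λ (q : Walk v s) → walkWeight q ≈ walkWeight p + weight H e
    snoc (single f s∈f u∈f) e u∈e v∈e = cons f s∈f u∈f (single e u∈e v∈e) ,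
      Eq.trans (+-cong Eq.refl (comm _ _)) (Eq.sym (assoc _ _ _))
    snoc (cons f s∈f y∈f p) e u∈e v∈e with q , eq ← snoc p e u∈e v∈e =
      cons f s∈f y∈f q , Eq.trans (+-cong Eq.refl eq) (Eq.sym (assoc _ _ _))

    walkWeight≥0 : ∀ {u v} (p : Walk v u) → 0# ≤ walkWeight p
    walkWeight≥0 (single e _ _)  = ≤-respʳ-≈ (Eq.sym (identityʳ _)) (weight≥0 H e)
    walkWeight≥0 (cons e _ _ p)  = ≤-trans (weight≥0 H e)
      (≤-respˡ-≈ (identityʳ _) (+-monoʳ-≤ (weight H e) (walkWeight≥0 p)))

    loop-at : ∀ s → Hyperpath H s s
    loop-at s with e , s∈e ← covers H s = proj₁ (fromWalk (single e s∈e s∈e))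

    -- Shortest distances

    shortest-≤-walk : ∀ {s v d} → ShortestDistance H s v d → (p : Walk v s) → d ≤⁺ [ walkWeight p ]
    shortest-≤-walk (source _ x≈0) p = [ ≤-respˡ-≈ (Eq.sym x≈0) (walkWeight≥0 p) ]
    shortest-≤-walk (minimum _ _ _ x≤) p with q , eq ← fromWalk p = [ subst (_ ≤_) eq (x≤ q) ]
    shortest-≤-walk (unreachable _ ∄p) p = contradiction (proj₁ (fromWalk p)) ∄p

    -- `tight` speaks of some shortest distances, not of entries of `D`; this lemma identifies the
    -- two. A hyperpath attaining the second distance bounds the first.
    shortest-unique-≤ : ∀ {s v d d′} → ShortestDistance H s v d →
                        ShortestDistance H s v d′ → d ≤⁺ d′
    shortest-unique-≤ (source _ x≈0) (source _ y≈0) = [ ≤-reflexive (Eq.trans x≈0 (Eq.sym y≈0)) ]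
    shortest-unique-≤ (minimum v≢s _ _ _) (source v≡s _) = contradiction v≡s v≢s
    shortest-unique-≤ (unreachable v≢s _) (source v≡s _) = contradiction v≡s v≢s
    shortest-unique-≤ sd (minimum _ p y≈ _) with q , eq ← toWalk p =
      ≤⁺-trans (shortest-≤-walk sd q) [ ≤-reflexive (Eq.trans (Eq.reflexive eq) (Eq.sym y≈)) ]
    shortest-unique-≤ _ (unreachable _ _) = _ ≤⊤⁺

    shortest-≥0 : ∀ {s v d} → ShortestDistance H s v d → [ 0# ] ≤⁺ d
    shortest-≥0 (source _ x≈0) = [ ≤-reflexive (Eq.sym x≈0) ]
    shortest-≥0 (minimum _ p x≈ _) with q , eq ← toWalk p =
      [ ≤-respʳ-≈ (Eq.sym x≈) (subst (0# ≤_) eq (walkWeight≥0 q)) ]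
    shortest-≥0 (unreachable _ _) = _ ≤⊤⁺

    shortest-source : ∀ {s d} → ShortestDistance H s s d → d ≈⁺ [ 0# ]
    shortest-source (source _ x≈0)       = [ x≈0 ]
    shortest-source (minimum s≢s _ _ _)  = contradiction refl s≢s
    shortest-source (unreachable s≢s _)  = contradiction refl s≢s

    -- Append `e` to a shortest hyperpath to `u`. For `u` equal to `s` the distance zero is not
    -- taken from a hyperpath, so `e` alone is used.
    shortest-step : ∀ {s u v du dv} e → u ∈ edge H e → v ∈ edge H e →
                    ShortestDistance H s u du → ShortestDistance H s v dv →
                    dv ≤⁺ du ∔ weight H e
    shortest-step e u∈e v∈e (source refl x≈0) sdv = begin
      _                     ≤⟨ shortest-≤-walk sdv (single e u∈e v∈e) ⟩
      [ weight H e + 0# ]   ≈⟨ [ comm _ _ ] ⟩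
      [ 0# + weight H e ]   ≈⟨ [ +-cong x≈0 Eq.refl ] ⟨
      _                     ∎
    shortest-step e u∈e v∈e (minimum _ p x≈ _) sdv
      with q , eq ← toWalk p
      with r , r≈ ← snoc q e u∈e v∈e = begin
      _                                 ≤⟨ shortest-≤-walk sdv r ⟩
      [ walkWeight r ]                  ≈⟨ [ r≈ ] ⟩
      [ walkWeight q + weight H e ]     ≡⟨ cong (λ x → [ x + weight H e ]) eq ⟩
      [ pathWeight H p + weight H e ]   ≈⟨ [ +-cong x≈ Eq.refl ] ⟨
      _                                 ∎
    shortest-step e u∈e v∈e (unreachable _ _) sdv = _ ≤⊤⁺

    shortest-reachable : ∀ {s v d} → ShortestDistance H s v d → d ≢ ⊤⁺ → Hyperpath H s v
    shortest-reachable (source refl _)     _   = loop-at _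
    shortest-reachable (minimum _ p _ _)   _   = p
    shortest-reachable (unreachable _ _)   ⊤≢⊤ = contradiction refl ⊤≢⊤

    shortest-finite : ∀ {s v d} → ShortestDistance H s v d → Hyperpath H s v → d ≢ ⊤⁺
    shortest-finite (unreachable _ ∄p) p refl = ∄p p

    -- Relaxation

    Relaxed : Labels n m → Fin m → Fin n → Fin n → Set _
    Relaxed L e u v = D L v ≤⁺ D L u ∔ weight H e

    RelaxedFrom : Labels n m → Fin n → Set _
    RelaxedFrom L u = ∀ {e v} → u ∈ edge H e → v ∈ edge H e → Relaxed L e u v

    -- The inequalities `D L v ≤⁺ D L u ∔ weight H e` telescope along the walk.
    relaxed-walk : ∀ {L u v} → (∀ y → RelaxedFrom L y) → (p : Walk v u) →
                   D L v ≤⁺ D L u ∔ walkWeight p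
    relaxed-walk {L} {u} {v} rel (single e u∈e v∈e) = begin
      D L v                       ≤⟨ rel u u∈e v∈e ⟩
      D L u ∔ weight H e          ≈⟨ ∔-congˡ (D L u) (identityʳ _) ⟨
      D L u ∔ (weight H e + 0#)   ∎
    relaxed-walk {L} {u} {v} rel (cons {y = y} e u∈e y∈e p) = begin
      D L v                                 ≤⟨ relaxed-walk {L} rel p ⟩
      D L y ∔ walkWeight p                  ≤⟨ ∔-monoˡ-≤⁺ _ (rel u u∈e y∈e) ⟩
      D L u ∔ weight H e ∔ walkWeight p     ≈⟨ ∔-assoc (D L u) _ _ ⟩
      D L u ∔ (weight H e + walkWeight p)   ∎

    lower : Fin n → State n m → Fin m × Fin n → State n m
    lower z (L , Q) (e , v) =
      record { D = updateAt (D L) v (const (D L z ∔ weight H e))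
             ; P = updateAt (P L) v (const (just z))
             ; E = updateAt (E L) v (const (just e))
             } , Q ∪ ⁅ v ⁆

    -- `relax` branches on `does` and forgets the evidence. Matching on the view fixes the resulting
    -- state and returns what the comparison proved.
    data RelaxView (z : Fin n) (σ : State n m) (ev : Fin m × Fin n) :
                   State n m → Set (c ⊔ ℓ₁ ⊔ ℓ₂) where
      kept    : Relaxed (labels σ) (proj₁ ev) z (proj₂ ev) → RelaxView z σ ev σ
      lowered : D (labels σ) z ∔ weight H (proj₁ ev) <⁺ D (labels σ) (proj₂ ev) →
                RelaxView z σ ev (lower z σ ev)

    relaxView : ∀ z σ ev → RelaxView z σ ev (relax H z σ ev)
    relaxView z (L , Q) (e , v) with D L z ∔ weight H e <⁺? D L v
    ... | yes lt = lowered lt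
    ... | no ¬lt = kept (≮⁺⇒≥⁺ ¬lt)

    module Lower (z : Fin n) (σ : State n m) (e : Fin m) (v : Fin n)
                 (lt : D (labels σ) z ∔ weight H e <⁺ D (labels σ) v) where

      L L′ : Labels n m
      L  = labels σ
      L′ = labels (lower z σ (e , v))

      D-at : D L′ v ≡ D L z ∔ weight H e
      D-at = updateAt-updates v (D L)

      P-at : P L′ v ≡ just z
      P-at = updateAt-updates v (P L)

      E-at : E L′ v ≡ just e
      E-at = updateAt-updates v (E L)

      D-off : ∀ {y} → y ≢ v → D L′ y ≡ D L y
      D-off = updateAt-minimal _ v (D L)

      P-off : ∀ {y} → y ≢ v → P L′ y ≡ P L y
      P-off = updateAt-minimal _ v (P L)

      E-off : ∀ {y} → y ≢ v → E L′ y ≡ E L y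
      E-off = updateAt-minimal _ v (E L)

      -- As weights are nonnegative, the old value of `v` strictly exceeds that of `z`. This is what
      -- protects the pivot, the source, the dequeued vertices and the ancestors of `z` from being
      -- overwritten.
      ≤z⇒≢v : ∀ {y} → D L y ≤⁺ D L z → y ≢ v
      ≤z⇒≢v {y} y≤z refl = <⁺⇒≱⁺ lt (≤⁺-trans y≤z (≤⁺-∔ (D L z) (weight≥0 H e)))

      z-off : D L′ z ≡ D L z
      z-off = D-off (≤z⇒≢v ≤⁺-refl)

      decreasing : ∀ y → D L′ y ≤⁺ D L y
      decreasing y with y ≟ v
      ... | yes refl = ≤⁺-trans (≡⇒≤⁺ D-at) (<⁺⇒≤⁺ lt)
      ... | no y≢v   = ≡⇒≤⁺ (D-off y≢v)

    -- The effect of a run of relaxations from one pivot `z`. Each lowering enqueues its vertex, so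
    -- a vertex outside the final queue was never touched.
    record Progress (z : Fin n) (σ τ : State n m) : Set (c ⊔ ℓ₂) where
      field
        pivot      : D (labels τ) z ≡ D (labels σ) z
        decreasing : ∀ v → D (labels τ) v ≤⁺ D (labels σ) v
        unqueued   : ∀ {v} → v ∉ queue τ → v ∉ queue σ × D (labels τ) v ≡ D (labels σ) v

    progress-refl : ∀ {z σ} → Progress z σ σ
    progress-refl = record
      { pivot = refl ; decreasing = λ _ → ≤⁺-refl ; unqueued = λ v∉Q → v∉Q , refl }

    progress-trans : ∀ {z ρ σ τ} → Progress z ρ σ → Progress z σ τ → Progress z ρ τ
    progress-trans p q = record
      { pivot      = trans q.pivot p.pivot
      ; decreasing = λ v → ≤⁺-trans (q.decreasing v) (p.decreasing v)
      ; unqueued   = λ v∉ → let v∉σ , eq = q.unqueued v∉ ; v∉ρ , eq′ = p.unqueued v∉σ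
                            in v∉ρ , trans eq eq′
      }
      where
      module p = Progress p
      module q = Progress q

    relax-progress : ∀ z σ ev → Progress z σ (relax H z σ ev)
    relax-progress z σ (e , v) with relax H z σ (e , v) | relaxView z σ (e , v)
    ... | _ | kept _ = progress-refl
    ... | _ | lowered lt = record
      { pivot      = z-off
      ; decreasing = decreasing
      ; unqueued   = λ {y} y∉ → y∉ ∘ p⊆p∪q ⁅ v ⁆ ,
          D-off λ { refl → y∉ (q⊆p∪q (queue σ) ⁅ v ⁆ (x∈⁅x⁆ v)) }
      }
      where open Lower z σ e v lt

    relax-relaxes : ∀ z σ ev → Relaxed (labels (relax H z σ ev)) (proj₁ ev) z (proj₂ ev)
    relax-relaxes z σ (e , v) with relax H z σ (e , v) | relaxView z σ (e , v)
    ... | _ | kept rel = rel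
    ... | _ | lowered lt = ≡⇒≤⁺
          (trans D-at (cong (_∔ weight H e) (sym z-off)))
      where open Lower z σ e v lt

    -- The left side can only fall, and the right side depends on the fixed value of the pivot.
    relaxed-progress : ∀ {z σ τ e v} → Progress z σ τ →
                       Relaxed (labels σ) e z v → Relaxed (labels τ) e z v
    relaxed-progress {e = e} {v} p rel = ≤⁺-trans (decreasing v)
      (≤⁺-trans rel (≡⇒≤⁺ (cong (_∔ weight H e) (sym pivot))))
      where open Progress p

    relax-all : ∀ z σ evs → let τ = foldl (relax H z) σ evs in
                Progress z σ τ × All (λ (e , v) → Relaxed (labels τ) e z v) evs
    relax-all z σ []         = progress-refl , []
    relax-all z σ (ev ∷ evs) with p , rel ← relax-all z (relax H z σ ev) evs =
      progress-trans (relax-progress z σ ev) p ,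
      relaxed-progress p (relax-relaxes z σ ev) ∷ rel

    relax-all-preserves : ∀ {p r z} {I : State n m → Set p} {R : Fin m × Fin n → Set r} →
      (∀ σ {ev} → R ev → I σ → I (relax H z σ ev)) →
      ∀ {evs} → All R evs → ∀ σ → I σ → I (foldl (relax H z) σ evs)
    relax-all-preserves step []       σ i = i
    relax-all-preserves step (r ∷ rs) σ i = relax-all-preserves step rs _ (step σ r i)

    -- Termination

    -- S collects the dequeued vertices. Keys never fall below the current
    -- minimum, so none of them is enqueued again.

    record Frontier (S : Subset n) (z : Fin n) (σ : State n m) : Set (c ⊔ ℓ₂) where
      field
        settled   : ∀ {y} → y ∈ S → y ∉ queue σ
        settled≤z : ∀ {y} → y ∈ S → D (labels σ) y ≤⁺ D (labels σ) z
        z≤queued  : ∀ {y} → y ∈ queue σ → D (labels σ) z ≤⁺ D (labels σ) y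

    -- A lowered vertex had a value above that of `z`, hence is not settled, and its new key is
    -- still at least the value of `z`.
    relax-frontier : ∀ {S z} σ {ev} → Frontier S z σ → Frontier S z (relax H z σ ev)
    relax-frontier {S} {z} σ {e , v} F with relax H z σ (e , v) | relaxView z σ (e , v)
    ... | _ | kept _ = F
    ... | _ | lowered lt = record
      { settled   = λ y∈S y∈Q′ → case-queue y∈S (x∈p∪q⁻ (queue σ) ⁅ v ⁆ y∈Q′)
      ; settled≤z = λ {y} y∈S → begin
          D L′ y  ≤⟨ decreasing y ⟩
          D L y   ≤⟨ settled≤z y∈S ⟩
          D L z   ≡⟨ z-off ⟨
          D L′ z  ∎
      ; z≤queued  = queued
      }
      where
      open Lower z σ e v lt
      open Frontier F
      case-queue : ∀ {y} → y ∈ S → ¬ (y ∈ queue σ ⊎ y ∈ ⁅ v ⁆)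
      case-queue y∈S (inj₁ y∈Q) = settled y∈S y∈Q
      case-queue y∈S (inj₂ y∈v) = ≤z⇒≢v (settled≤z y∈S) (x∈⁅y⁆⇒x≡y v y∈v)
      queued : ∀ {y} → y ∈ queue σ ∪ ⁅ v ⁆ → D L′ z ≤⁺ D L′ y
      queued {y} y∈Q′ with y ≟ v | x∈p∪q⁻ (queue σ) ⁅ v ⁆ y∈Q′
      ... | yes refl | _ = begin
        D L′ z              ≡⟨ z-off ⟩
        D L z               ≤⟨ ≤⁺-∔ (D L z) (weight≥0 H e) ⟩
        D L z ∔ weight H e  ≡⟨ D-at ⟨
        D L′ v              ∎
      ... | no y≢v | inj₁ y∈Q = begin
        D L′ z  ≡⟨ z-off ⟩
        D L z   ≤⟨ z≤queued y∈Q ⟩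
        D L y   ≡⟨ D-off y≢v ⟨
        D L′ y  ∎
      ... | no y≢v | inj₂ y∈v = contradiction (x∈⁅y⁆⇒x≡y v y∈v) y≢v

    -- With `S` empty both side conditions are vacuous, so any state may be the start. Each
    -- iteration adds the dequeued vertex, which is new because settled vertices are not queued, and
    -- subsets of a finite set cannot grow strictly for ever.
    terminating : ∀ σ → Terminating H σ
    terminating σ = go ⊥ (⊃-wellFounded ⊥) σ
      (λ y∈⊥ → contradiction y∈⊥ ∉⊥) (λ y∈⊥ → contradiction y∈⊥ ∉⊥)
      where
      go : ∀ S → Acc _⊃_ S → ∀ σ → (∀ {y} → y ∈ S → y ∉ queue σ) →
           (∀ {y u} → y ∈ S → u ∈ queue σ → D (labels σ) y ≤⁺ D (labels σ) u) →
           Terminating H σ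
      go S (acc rs) (L , Q) settled S≤Q = acc next
        where
        settled≤z : ∀ {y z} → z ∈ Q → y ∈ S ⊎ y ∈ ⁅ z ⁆ → D L y ≤⁺ D L z
        settled≤z     z∈Q (inj₁ y∈S) = S≤Q y∈S z∈Q
        settled≤z {z = z} z∈Q (inj₂ y∈z) with refl ← x∈⁅y⁆⇒x≡y z y∈z = ≤⁺-refl

        frontier : ∀ {z} → ArgMin H L Q z → Frontier (S ∪ ⁅ z ⁆) z (L , (Q ─ ⁅ z ⁆))
        frontier {z} (z∈Q , z≤) = record
          { settled   = λ y∈ y∈Q─z → case-settled (x∈p∪q⁻ S ⁅ z ⁆ y∈) y∈Q─z
          ; settled≤z = λ y∈ → settled≤z z∈Q (x∈p∪q⁻ S ⁅ z ⁆ y∈)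
          ; z≤queued  = λ y∈Q─z → z≤ (p─q⊆p Q ⁅ z ⁆ y∈Q─z)
          }
          where
          case-settled : ∀ {y} → y ∈ S ⊎ y ∈ ⁅ z ⁆ → y ∉ Q ─ ⁅ z ⁆
          case-settled (inj₁ y∈S) y∈Q─z = settled y∈S (p─q⊆p Q ⁅ z ⁆ y∈Q─z)
          case-settled (inj₂ y∈z) y∈Q─z = x∈p─q⇒x∉q Q ⁅ z ⁆ y∈Q─z y∈z

        next : ∀ {τ} → _⟶_ H (L , Q) τ → Terminating H τ
        next (step₂ {z = z} {evs} min@(z∈Q , _) _) = go (S ∪ ⁅ z ⁆)
          (rs (p⊆p∪q ⁅ z ⁆ , z , q⊆p∪q S ⁅ z ⁆ (x∈⁅x⁆ z) , λ z∈S → settled z∈S z∈Q))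
          _ (Frontier.settled F)
          -- The value of `z` separates the settled values from the queued ones.
          (λ y∈ u∈ → ≤⁺-trans (Frontier.settled≤z F y∈) (Frontier.z≤queued F u∈))
          where
          F = relax-all-preserves {R = λ _ → ⊤} (λ σ _ → relax-frontier σ)
                (All.universal (λ _ → _) evs) _ (frontier min)

    -- The tree invariant and its consequences

    module _ (s : Fin n) where

      -- `parent` asks for an inequality because `D L u` may drop after `v` was last assigned, and
      -- because the weight of a tree hyperedge may itself have decreased. Equality returns once all
      -- vertices are relaxed.
      record Invariant (L : Labels n m) : Set (c ⊔ ℓ₁ ⊔ ℓ₂) where
        field
          root      : P L s ≡ nothing
          atSource  : D L s ≈⁺ [ 0# ]
          nonneg    : ∀ v → [ 0# ] ≤⁺ D L v
          finite    : ∀ {v u} → P L v ≡ just u → D L v ≢ ⊤⁺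
          parent    : ∀ {v u} → P L v ≡ just u → ∃ λ e → E L v ≡ just e ×
                      v ∈ edge H e × u ∈ edge H e × D L u ∔ weight H e ≤⁺ D L v
          connected : ∀ {v} → D L v ≢ ⊤⁺ → Star (λ a b → P L a ≡ just b) v s

      relax-invariant : ∀ {z} σ {ev} → z ∈ edge H (proj₁ ev) × proj₂ ev ∈ edge H (proj₁ ev) →
                        Invariant (labels σ) → Invariant (labels (relax H z σ ev))
      relax-invariant {z} σ {e , v} (z∈e , v∈e) I
        with relax H z σ (e , v) | relaxView z σ (e , v)
      ... | _ | kept _ = I
      ... | _ | lowered lt = record
        { root      = trans (P-off s≢v) root
        ; atSource  = Eq⁺.trans (Eq⁺.reflexive (D-off s≢v)) atSource
        ; nonneg    = nonneg′
        ; finite    = finite′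
        ; parent    = parent′
        ; connected = connected′
        }
        where
        open Lower z σ e v lt
        open Invariant I

        s≢v : s ≢ v
        s≢v = ≤z⇒≢v (≤⁺-trans (≤⁺-reflexive atSource) (nonneg z))

        nonneg′ : ∀ y → [ 0# ] ≤⁺ D L′ y
        nonneg′ y with y ≟ v
        ... | no y≢v   = subst ([ 0# ] ≤⁺_) (sym (D-off y≢v)) (nonneg y)
        ... | yes refl = subst ([ 0# ] ≤⁺_) (sym D-at)
                           (≤⁺-trans (nonneg z) (≤⁺-∔ (D L z) (weight≥0 H e)))

        finite′ : ∀ {y u} → P L′ y ≡ just u → D L′ y ≢ ⊤⁺
        finite′ {y} eq with y ≟ v
        ... | no y≢v   = ≢⊤⁺-≤⁺ (decreasing y) (finite (trans (sym (P-off y≢v)) eq))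
        ... | yes refl = <⁺⇒≢⊤⁺ lt ∘ trans (sym D-at)

        parent′ : ∀ {y u} → P L′ y ≡ just u → ∃ λ f → E L′ y ≡ just f ×
                  y ∈ edge H f × u ∈ edge H f × D L′ u ∔ weight H f ≤⁺ D L′ y
        parent′ {y} {u} eq with y ≟ v
        ... | yes refl with refl ← trans (sym P-at) eq =
          e , E-at , v∈e , z∈e ,
          ≡⇒≤⁺ (trans (cong (_∔ weight H e) z-off) (sym D-at))
        ... | no y≢v with f , Ey , y∈f , u∈f , le ← parent (trans (sym (P-off y≢v)) eq) =
          f , trans (E-off y≢v) Ey , y∈f , u∈f , (begin
            D L′ u ∔ weight H f  ≤⟨ ∔-monoˡ-≤⁺ (weight H f) (decreasing u) ⟩
            D L u ∔ weight H f   ≤⟨ le ⟩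
            D L y                ≡⟨ D-off y≢v ⟨
            D L′ y               ∎)

        -- D does not increase towards the root, so v, whose value strictly
        -- exceeds D z, is not an ancestor of z: no cycle arises.

        keep : ∀ {y} → D L y ≤⁺ D L z → Star (λ a b → P L a ≡ just b) y s →
               Star (λ a b → P L′ a ≡ just b) y s
        keep y≤z ε = ε
        keep y≤z (Py≡u ◅ us) with f , _ , _ , _ , le ← parent Py≡u =
          trans (P-off (≤z⇒≢v y≤z)) Py≡u ◅
          keep (≤⁺-trans (≤⁺-∔ _ (weight≥0 H f)) (≤⁺-trans le y≤z)) us

        v⇝s : Star (λ a b → P L′ a ≡ just b) v s
        -- `D L z ∔ weight H e` lies strictly below another distance, so `D L z` is finite and `z`
        -- already has a path to `s`.
        v⇝s = P-at ◅ keep ≤⁺-refl (connected (∔-≢⊤⁺ (<⁺⇒≢⊤⁺ lt)))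

        -- An old path that meets `v` is cut there and continued along `v⇝s`; elsewhere its pointers
        -- are unchanged.
        reroute : ∀ {y} → Star (λ a b → P L a ≡ just b) y s →
                  Star (λ a b → P L′ a ≡ just b) y s
        reroute ε = ε
        reroute {y} (Py≡u ◅ us) with y ≟ v
        ... | yes refl = v⇝s
        ... | no y≢v   = trans (P-off y≢v) Py≡u ◅ reroute us

        connected′ : ∀ {y} → D L′ y ≢ ⊤⁺ → Star (λ a b → P L′ a ≡ just b) y s
        connected′ {y} y≢⊤ with y ≟ v
        ... | yes refl = v⇝s
        ... | no y≢v   = reroute (connected (y≢⊤ ∘ trans (D-off y≢v)))

      -- The walk `p` is an accumulator: each move to a parent prepends the tree hyperedge, and by
      -- `parent` the value at the current vertex plus the accumulated weight does not grow.
      trace-back : ∀ {L u v} → Invariant L → Star (λ a b → P L a ≡ just b) u s → (p : Walk v u) →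
                   ∃ λ (q : Walk v s) → D L s ∔ walkWeight q ≤⁺ D L u ∔ walkWeight p
      trace-back I ε p = p , ≤⁺-refl
      trace-back {L} {u} I (_◅_ {j = y} Pu≡y ys) p
        with e , _ , u∈e , y∈e , le ← Invariant.parent I Pu≡y
        with q , q≤ ← trace-back I ys (cons e y∈e u∈e p) = q , (begin
          D L s ∔ walkWeight q                  ≤⟨ q≤ ⟩
          D L y ∔ (weight H e + walkWeight p)   ≈⟨ ∔-assoc (D L y) _ _ ⟨
          D L y ∔ weight H e ∔ walkWeight p     ≤⟨ ∔-monoˡ-≤⁺ _ le ⟩
          D L u ∔ walkWeight p                  ∎)

      -- A walk has at least one hyperedge while the tree path of `s` has none, so `v` must differ
      -- from `s`; its first tree hyperedge starts the accumulator.
      tree-walk : ∀ {L v} → Invariant L → Star (λ a b → P L a ≡ just b) v s → v ≢ s →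
                  ∃ λ (q : Walk v s) → [ walkWeight q ] ≤⁺ D L v
      tree-walk I ε s≢s = contradiction refl s≢s
      tree-walk {L} {v} I (_◅_ {j = u} Pv≡u us) _
        with e , _ , v∈e , u∈e , le ← Invariant.parent I Pv≡u
        with q , q≤ ← trace-back I us (single e u∈e v∈e) = q , (begin
          [ walkWeight q ]            ≈⟨ [ identityˡ _ ] ⟨
          [ 0# ] ∔ walkWeight q       ≈⟨ ∔-congʳ _ (Invariant.atSource I) ⟨
          D L s ∔ walkWeight q        ≤⟨ q≤ ⟩
          D L u ∔ (weight H e + 0#)   ≈⟨ ∔-congˡ (D L u) (identityʳ _) ⟩
          D L u ∔ weight H e          ≤⟨ le ⟩
          D L v                       ∎)

      relaxed⇒correct : ∀ {L} → Invariant L → (∀ v → RelaxedFrom L v) → Correct H s L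
      relaxed⇒correct {L} I rel = record
        { distances = λ v → shortest v (D L v) refl
        ; pointers  = record
          { root      = root
          ; supported = λ Pv≡u → finite⇒reachable (finite Pv≡u)
          ; connected = connected ∘ reachable⇒finite
          ; tight     = λ p v≢s → tight (connected (reachable⇒finite p)) v≢s
          }
        }
        where
        open Invariant I

        lower-bound : ∀ {v} (p : Hyperpath H s v) → D L v ≤⁺ [ pathWeight H p ]
        lower-bound {v} p with q , eq ← toWalk p = begin
          D L v                    ≤⟨ relaxed-walk {L} rel q ⟩
          D L s ∔ walkWeight q     ≈⟨ ∔-congʳ _ atSource ⟩
          [ 0# ] ∔ walkWeight q    ≈⟨ [ identityˡ _ ] ⟩
          [ walkWeight q ]         ≡⟨ cong [_] eq ⟩
          [ pathWeight H p ]       ∎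

        reachable⇒finite : ∀ {v} → Hyperpath H s v → D L v ≢ ⊤⁺
        reachable⇒finite p = ≢⊤⁺-≤⁺ (lower-bound p) λ ()

        finite⇒reachable : ∀ {v} → D L v ≢ ⊤⁺ → Hyperpath H s v
        finite⇒reachable {v} v≢⊤ with v ≟ s
        ... | yes refl = loop-at s
        ... | no v≢s   = proj₁ (fromWalk (proj₁ (tree-walk I (connected v≢⊤) v≢s)))

        -- Tying `d` to `D L v` by an equation allows a split on whether the value is finite. A
        -- finite value is attained by the tree walk, squeezed between `lower-bound` and
        -- `tree-walk`.
        shortest : ∀ v d → D L v ≡ d → ShortestDistance H s v d
        shortest v d eq with v ≟ s
        shortest v ⊤⁺ eq | yes refl with () ← subst (_≈⁺ [ 0# ]) eq atSource
        shortest v [ x ] eq | yes refl with [ x≈0 ] ← subst (_≈⁺ [ 0# ]) eq atSource =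
          source refl x≈0
        shortest v ⊤⁺ eq | no v≢s = unreachable v≢s λ p → reachable⇒finite p eq
        shortest v [ x ] eq | no v≢s
          with q , q≤ ← tree-walk I (connected λ v≡⊤ → contradiction (trans (sym eq) v≡⊤) λ ()) v≢s
          with p , p≡q ← fromWalk q
          with [ q≤x ] ← subst ([ walkWeight q ] ≤⁺_) eq q≤ =
          minimum v≢s p
            (antisym (x≤ p) (subst (_≤ x) (sym p≡q) q≤x)) x≤
          where
          x≤ : ∀ r → x ≤ pathWeight H r
          x≤ r with [ x≤r ] ← subst (_≤⁺ [ pathWeight H r ]) eq (lower-bound r) = x≤r

        tight : ∀ {v} → Star (λ a b → P L a ≡ just b) v s → v ≢ s → _
        tight ε s≢s = contradiction refl s≢s
        -- The first pointer on the way to `s` gives the parent; `parent` supplies one half of the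
        -- equality and relaxedness at `u` the other.
        tight {v} (_◅_ {j = u} Pv≡u _) _ with e , Ev≡e , v∈e , u∈e , le ← parent Pv≡u =
          u , e , Pv≡u , Ev≡e , v∈e , u∈e , D L v , D L u ,
          shortest v _ refl , shortest u _ refl , ≤⁺-antisym (rel u u∈e v∈e) le

      -- The loop of step 2

      all-incident : ∀ {z evs} → evs ↭ incidences H z →
                     All (λ (e , v) → z ∈ edge H e × v ∈ edge H e) evs
      all-incident {z} perm = All-resp-↭ (↭-sym perm) (all-filter
        (λ (e , v) → (z ∈? edge H e) ×-dec (v ∈? edge H e))
        (cartesianProduct (allFin m) (allFin n)))

      -- Lowering `u` may break the inequalities out of `u`, but it also enqueues `u`; the queue
      -- thus holds every vertex whose inequalities may fail.
      record LoopInvariant (σ : State n m) : Set (c ⊔ ℓ₁ ⊔ ℓ₂) where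
        field
          invariant : Invariant (labels σ)
          relaxed   : ∀ {u} → u ∉ queue σ → RelaxedFrom (labels σ) u

      -- All incidences of the dequeued `z` have been relaxed. Any other vertex outside the new
      -- queue was outside the old one and kept its value, while the values it is compared with only
      -- fell.
      loop-step : ∀ {σ τ} → _⟶_ H σ τ → LoopInvariant σ → LoopInvariant τ
      loop-step (step₂ {L} {Q} {z} {evs} _ perm) I = record
        { invariant = relax-all-preserves {I = Invariant ∘ labels} relax-invariant
            (all-incident perm) _ invariant
        ; relaxed   = relaxed′
        }
        where
        open LoopInvariant I
        σ′ : State n m
        σ′ = foldl (relax H z) (L , (Q ─ ⁅ z ⁆)) evs
        L′ = labels σ′

        prog : Progress z (L , (Q ─ ⁅ z ⁆)) σ′
        prog = proj₁ (relax-all z _ evs)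
        open Progress prog

        relaxed′ : ∀ {u} → u ∉ queue σ′ → RelaxedFrom L′ u
        relaxed′ {u} u∉Q′ {e} {v} u∈e v∈e with u ≟ z
        ... | yes refl = All.lookup (proj₂ (relax-all z _ evs)) (∈-resp-↭ (↭-sym perm)
                (∈-filter⁺ (λ (e , v) → (z ∈? edge H e) ×-dec (v ∈? edge H e))
                  (∈-cartesianProduct⁺ (∈-allFin e) (∈-allFin v)) (u∈e , v∈e)))
        ... | no u≢z with u∉Q─z , Du ← unqueued u∉Q′ = begin
          D L′ v               ≤⟨ decreasing v ⟩
          D L v                ≤⟨ relaxed (u∉Q─z ∘ λ u∈Q → x∈p∧x∉q⇒x∈p─q u∈Q (x≢y⇒x∉⁅y⁆ u≢z)) u∈e v∈e ⟩
          D L u ∔ weight H e   ≡⟨ cong (_∔ weight H e) Du ⟨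
          D L′ u ∔ weight H e  ∎

      loop-invariant : ∀ {σ τ} → Star (_⟶_ H) σ τ → LoopInvariant σ → LoopInvariant τ
      loop-invariant ε              I = I
      loop-invariant (step ◅ steps) I = loop-invariant steps (loop-step step I)

      halted⇒correct : ∀ {σ} → LoopInvariant σ → Empty (queue σ) → Correct H s (labels σ)
      halted⇒correct I empty = relaxed⇒correct (LoopInvariant.invariant I)
        λ v → LoopInvariant.relaxed I λ v∈Q → empty (v , v∈Q)

  -- The change of weight and step 1

  module _ {n m : ℕ} (H : Hypergraph n m) (s : Fin n) (ě : Fin m)
           (w : Carrier) (0≤w : 0# ≤ w) (w<weight : w < weight H ě)
           {L : Labels n m} (correct : Correct H s L) where

    private
      H′ = reweight H ě w 0≤w
    open Correct correct
    open CorrectPointers pointers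

    weight-at : weight H′ ě ≡ w
    weight-at = updateAt-updates ě (weight H)

    weight-off : ∀ {e} → e ≢ ě → weight H′ e ≡ weight H e
    weight-off = updateAt-minimal _ ě (weight H)

    weight-decreases : ∀ e → weight H′ e ≤ weight H e
    weight-decreases e with e ≟ ě
    ... | yes refl = subst (_≤ weight H e) (sym weight-at) (proj₁ w<weight)
    ... | no e≢ě   = ≤-reflexive (Eq.reflexive (weight-off e≢ě))

    -- Among the fields only `parent` involves weights, and a smaller weight turns the old equality
    -- of `tight` into the required inequality.
    initial-invariant : Invariant H′ s L
    initial-invariant = record
      { root      = root
      ; atSource  = shortest-source H (distances s)
      ; nonneg    = λ v → shortest-≥0 H (distances v)
      ; finite    = λ {v} Pv≡u → shortest-finite H (distances v) (supported Pv≡u)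
      ; parent    = parent
      ; connected = λ {v} v≢⊤ → connected (shortest-reachable H (distances v) v≢⊤)
      }
      where
      parent : ∀ {v u} → P L v ≡ just u → ∃ λ e → E L v ≡ just e ×
               v ∈ edge H e × u ∈ edge H e × D L u ∔ weight H′ e ≤⁺ D L v
      parent {v} {u} Pv≡u
        -- `tight` names its own parent `u′`, identified with `u` through `P L v`; `v` is not the
        -- source, which has no parent.
        with u′ , e , Pv≡u′ , Ev≡e , v∈e , u∈e , x , y , sdv , sdu , x≈ ←
               tight (supported Pv≡u) (λ { refl → contradiction (trans (sym root) Pv≡u) λ () })
        with refl ← trans (sym Pv≡u) Pv≡u′ =
        e , Ev≡e , v∈e , u∈e , (begin
          D L u ∔ weight H′ e  ≤⟨ ∔-monoʳ-≤⁺ (D L u) (weight-decreases e) ⟩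
          D L u ∔ weight H e   ≤⟨ ∔-monoˡ-≤⁺ _ (shortest-unique-≤ H (distances u) sdu) ⟩
          y ∔ weight H e       ≈⟨ x≈ ⟨
          x                    ≤⟨ shortest-unique-≤ H sdv (distances v) ⟩
          D L v                ∎)

    -- For hyperedges other than `ě` the old triangle inequality persists. For `ě`, relaxing from
    -- the minimiser `x` suffices, since `D L x` is at most `D L u` for every `u` in `ě`.
    step₁-establishes : ∀ {σ} → Step₁ H′ ě L σ → LoopInvariant H′ s σ
    step₁-establishes (step₁ {x} {vs} (x∈ě , x≤) perm) =
      -- The loop over vertices is rewritten as a loop over pairs with first component `ě`, the form
      -- that `relax-all` handles.
      subst (LoopInvariant H′ s) (foldl-map (relax H′ x) (ě ,_) (L , ⊥) vs) record
        { invariant = relax-all-preserves H′ {I = Invariant H′ s ∘ labels} (relax-invariant H′ s)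
            (All-map⁺ (All-resp-↭ (↭-sym perm)
              (All.map (x∈ě ,_) (all-filter (_∈? edge H ě) (allFin n))))) _ initial-invariant
        ; relaxed   = relaxed
        }
      where
      σ′ : State n m
      σ′ = foldl (relax H′ x) (L , ⊥) (map (ě ,_) vs)
      L′ = labels σ′
      progress-all = relax-all H′ x (L , ⊥) (map (ě ,_) vs)
      open Progress (proj₁ progress-all)

      relaxed : ∀ {u} → u ∉ queue σ′ → RelaxedFrom H′ L′ u
      relaxed {u} u∉Q′ {e} {v} u∈e v∈e with e ≟ ě
      ... | yes refl = begin
        D L′ v                ≤⟨ All.lookup (All-map⁻ (proj₂ progress-all))
                                   (∈-resp-↭ (↭-sym perm)
                                     (∈-filter⁺ (_∈? edge H ě) (∈-allFin v) v∈e)) ⟩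
        D L′ x ∔ weight H′ e  ≡⟨ cong (_∔ weight H′ e) pivot ⟩
        D L x ∔ weight H′ e   ≤⟨ ∔-monoˡ-≤⁺ _ (x≤ u∈e) ⟩
        D L u ∔ weight H′ e   ≡⟨ cong (_∔ weight H′ e) (proj₂ (unqueued u∉Q′)) ⟨
        D L′ u ∔ weight H′ e  ∎
      ... | no e≢ě = begin
        D L′ v                ≤⟨ decreasing v ⟩
        D L v                 ≤⟨ shortest-step H e u∈e v∈e (distances u) (distances v) ⟩
        D L u ∔ weight H e    ≡⟨ cong (D L u ∔_) (weight-off e≢ě) ⟨
        D L u ∔ weight H′ e   ≡⟨ cong (_∔ weight H′ e) (proj₂ (unqueued u∉Q′)) ⟨
        D L′ u ∔ weight H′ e  ∎

    execution-correct : ∀ {L′} → Execution H′ ě L L′ → Correct H′ s L′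
    execution-correct record { first = first ; loop = loop ; halted = halted ; output = refl } =
      halted⇒correct H′ s (loop-invariant H′ s loop (step₁-establishes first)) halted

theorem1 :
    ∀ {c ℓ₁ ℓ₂} (G : OrderedAbelianGroup c ℓ₁ ℓ₂) →
    let open OrderedAbelianGroup G
        open HyperpathDefs G
    in
    ∀ {n m : ℕ} (H : Hypergraph n m) (s : Fin n) (ě : Fin m)
      (wnew : Carrier) (0≤wnew : 0# ≤ wnew) → wnew < weight H ě →
    (L : Labels n m) → Correct H s L →
    let H′ = reweight H ě wnew 0≤wnew in
    (∀ {σ} → Step₁ H′ ě L σ → Terminating H′ σ) ×
    (∀ {L′} → Execution H′ ě L L′ → Correct H′ s L′)
theorem1 G H s ě wnew 0≤wnew wnew<w L correct =
  (λ _ → terminating G (reweight G H ě wnew 0≤wnew) _) ,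
  execution-correct G H s ě wnew 0≤wnew wnew<w correct
  where open HyperpathDefs
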